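{- For all $n\ge k\ge3$, $$\mathbf{Sf}_{n,k}(p,1)\big|_{p^1}=\binom{k-1}{2}\binom{n-1}{k}.$$
   Context: $F_1(p,q)=q$, $F_2(p,q)=q^2$ and $F_m(p,q)=qF_{m-1}(p,q)+pF_{m-2}(p,q)$ for $m\ge3$. Let $(x)_{\downarrow_{F,p,q,0}}=1$ and $(x)_{\downarrow_{F,p,q,k}}=x(x-F_1(p,q))\cdots(x-F_{k-1}(p,q))$ for $k\ge1$. Define the polynomials $\mathbf{Sf}_{n,k}(p,q)$ for $0\le k\le n$ by $x^n=\sum_{k=0}^n\mathbf{Sf}_{n,k}(p,q)(x)_{\downarrow_{F,p,q,k}}$. $\mathbf{Sf}_{n,k}(p,1)$ is the specialization $q=1$, and $f|_{p^s}$ denotes the coefficient of $p^s$ in the polynomial $f$ in $p$. -}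

module Defs where

open import Algebra.Bundles using (RawRing)
open import Data.Fin.Base using (toℕ)
open import Data.Integer.Base using (+-*-rawRing)
open import Data.List.Base using (List; []; _∷_; map)
open import Data.Nat.Base using (ℕ; zero; suc)
open import Level using (Level; 0ℓ)

private
  variable
    c ℓ : Level

-- Univariate polynomials as coefficient lists, constant term first.  Trailing
-- zeros are allowed, so equality is equality of all coefficients.  Only raw
-- operations are required of the coefficients, so the construction iterates.
module Polynomials (R : RawRing c ℓ) where
  private module R = RawRing R

  Poly : Set c
  Poly = List R.Carrier

  coeff : Poly → ℕ → R.Carrier
  coeff []      _       = R.0#
  coeff (a ∷ _) zero    = a
  coeff (_ ∷ f) (suc i) = coeff f i

  infix 4 _≈ₚ_
  _≈ₚ_ : Poly → Poly → Set ℓ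
  f ≈ₚ g = ∀ i → coeff f i R.≈ coeff g i

  infixl 6 _+ₚ_
  _+ₚ_ : Poly → Poly → Poly
  []      +ₚ g       = g
  (a ∷ f) +ₚ []      = a ∷ f
  (a ∷ f) +ₚ (b ∷ g) = (a R.+ b) ∷ (f +ₚ g)

  infixl 7 _*ₚ_
  _*ₚ_ : Poly → Poly → Poly
  []      *ₚ g = []
  (a ∷ f) *ₚ g = map (a R.*_) g +ₚ (R.0# ∷ f *ₚ g)

  const : R.Carrier → Poly
  const a = a ∷ []

  var : Poly
  var = R.0# ∷ R.1# ∷ []

  eval : R.Carrier → Poly → R.Carrier
  eval x []      = R.0#
  eval x (a ∷ f) = a R.+ x R.* eval x f

  rawRing : RawRing c ℓ
  rawRing = record
    { Carrier = Poly
    ; _≈_     = _≈ₚ_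
    ; _+_     = _+ₚ_
    ; _*_     = _*ₚ_
    ; -_      = map R.-_
    ; 0#      = []
    ; 1#      = const R.1#
    }

-- The polynomial rings ℤ[p], ℤ[p][q] and ℤ[p][q][x].

module P = Polynomials +-*-rawRing

ℤ[p] : RawRing 0ℓ 0ℓ
ℤ[p] = P.rawRing

module Q = Polynomials ℤ[p]

ℤ[p,q] : RawRing 0ℓ 0ℓ
ℤ[p,q] = Q.rawRing

module X = Polynomials ℤ[p,q]

ℤ[p,q,x] : RawRing 0ℓ 0ℓ
ℤ[p,q,x] = X.rawRing

p q : RawRing.Carrier ℤ[p,q]
p = Q.const P.var
q = Q.var

x : RawRing.Carrier ℤ[p,q,x]
x = X.var

-- The sequence starts at index 1; the value at index 0 is a filler and is
-- used neither by the later terms nor by the falling factorials below.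
F : ℕ → RawRing.Carrier ℤ[p,q]
F 0                   = RawRing.0# ℤ[p,q]
F 1                   = q
F 2                   = q * q
  where open RawRing ℤ[p,q]
F (suc (suc (suc m))) = q * F (suc (suc m)) + p * F (suc m)
  where open RawRing ℤ[p,q]

-- fallF k = x (x - F 1) ⋯ (x - F (k - 1))
fallF : ℕ → RawRing.Carrier ℤ[p,q,x]
fallF 0             = RawRing.1# ℤ[p,q,x]
fallF 1             = x
fallF (suc (suc k)) = fallF (suc k) * (x + - X.const (F (suc k)))
  where open RawRing ℤ[p,q,x]

-- The fallF k are monic of degree k, so these identities determine Sf n k
-- for k ≤ n; the values with k > n are unconstrained.
IsSf : (ℕ → ℕ → RawRing.Carrier ℤ[p,q]) → Set
IsSf Sf = ∀ n →
  x ^ n ≈ sum {suc n} (λ k → X.const (Sf n (toℕ k)) * fallF (toℕ k))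
  where
  open RawRing ℤ[p,q,x]
  open import Algebra.Definitions.RawSemiring rawSemiring using (sum; _^_)

infix 9 _⟨p,1⟩
_⟨p,1⟩ : RawRing.Carrier ℤ[p,q] → RawRing.Carrier ℤ[p]
f ⟨p,1⟩ = Q.eval (RawRing.1# ℤ[p]) f

{-# OPTIONS --safe #-}

-- Setting q = 1 and keeping only the coefficients of 1 and p amounts to the
-- ring homomorphism ℤ[p,q] → ℤ[ε]/(ε²), p ↦ ε, q ↦ 1, which maps F m to
-- 1 + (m - 2) ε for m ≥ 2 and F 1 to 1.  Let s(n,k) satisfy the Stirling recursion
-- s(n+1,k+1) = s(n,k) + F (k+1) s(n,k+1) over ℤ[ε]/(ε²).  The linear
-- functional xⁿ ↦ s(n,k) maps fallF j to δ(j,k), so the image of Sf n k is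
-- s(n,k), and Pascal's rule gives s(n+1,k+1) = C(n,k) + C(k,2) C(n,k+1) ε.

module Submission where

open import Defs
open import Algebra.Bundles using (RawRing; CommutativeRing)
open import Algebra.Morphism.Structures using (IsRingHomomorphism)
open import Data.Fin.Base as Fin using (toℕ)
open import Data.Integer.Base as ℤ using (+_)
import Data.Integer.Properties as ℤ
open import Data.Integer.Tactic.RingSolver using (solve-∀)
open import Data.List.Base using ([]; _∷_; map)
open import Data.Nat.Base as ℕ using (ℕ; zero; suc; _∸_; _≤_; _<_; s≤s)
open import Data.Nat.Combinatorics using (_C_; nC1≡n; nCk+nC[k+1]≡[n+1]C[k+1])
import Data.Nat.Properties as ℕ
import Data.Nat.Tactic.RingSolver as ℕ-Solver
open import Data.Product.Base using (_,_; proj₂)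
open import Function.Base using (_∘_)
open import Level using (Level; 0ℓ)
open import Relation.Binary.PropositionalEquality as ≡ using (_≡_)
import Algebra.Definitions.RawSemiring as RawSemiringDefinitions
import Algebra.Module.Construct.Idealization as Idealization
import Algebra.Module.Construct.TensorUnit as TensorUnit
import Algebra.Properties.Monoid.Sum as MonoidSum
import Algebra.Properties.Ring as RingProperties
import Algebra.Properties.Semiring.Exp as Exp
import Relation.Binary.Reasoning.Setoid as SetoidReasoning

private
  variable
    c ℓ c′ ℓ′ : Level

-- Semilinear functionals on polynomials, prescribed by their moments

module LinearFunctional
  {R : RawRing c ℓ} (S : CommutativeRing c′ ℓ′)
  {φ : RawRing.Carrier R → CommutativeRing.Carrier S}
  (φ-hom : IsRingHomomorphism R (CommutativeRing.rawRing S) φ)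
  where

  private module R = RawRing R
  open CommutativeRing S
  open IsRingHomomorphism φ-hom
  open Polynomials R renaming (rawRing to polyRawRing)
  open RingProperties ring using (-0#≈0#; -‿distribˡ-*; -‿+-comm)
  open Exp semiring using (_^_; ^-homo-*)
  open SetoidReasoning setoid
  open import Algebra.Properties.CommutativeSemigroup *-commutativeSemigroup
    using () renaming (x∙yz≈y∙xz to x*yz≈y*xz)
  open import Algebra.Properties.CommutativeSemigroup
    +-commutativeSemigroup using (interchange)

  -- The moment sequence `w` is left arbitrary because two kinds occur: columns of generalized
  -- Stirling numbers, and powers of a fixed element, for which `L` is evaluation.
  L : (ℕ → Carrier) → Poly → Carrier
  L w []      = 0#
  L w (a ∷ f) = φ a * w 0 + L (w ∘ suc) f

  L-congˡ : ∀ {v w} → (∀ i → v i ≈ w i) → ∀ f → L v f ≈ L w f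
  L-congˡ v≈w []      = refl
  L-congˡ v≈w (a ∷ f) = +-cong (*-congˡ (v≈w 0)) (L-congˡ (v≈w ∘ suc) f)

  L-+ˡ : ∀ v w f → L (λ i → v i + w i) f ≈ L v f + L w f
  L-+ˡ v w []      = sym (+-identityˡ 0#)
  L-+ˡ v w (a ∷ f) = trans
    (+-cong (distribˡ _ _ _) (L-+ˡ (v ∘ suc) (w ∘ suc) f))
    (interchange _ _ _ _)

  L-*ˡ : ∀ b w f → L (λ i → b * w i) f ≈ b * L w f
  L-*ˡ b w []      = sym (zeroʳ b)
  L-*ˡ b w (a ∷ f) = trans
    (+-cong (x*yz≈y*xz _ _ _) (L-*ˡ b (w ∘ suc) f))
    (sym (distribˡ _ _ _))

  L-zeroˡ : ∀ {w} → (∀ i → w i ≈ 0#) → ∀ f → L w f ≈ 0#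
  L-zeroˡ w≈0 []      = refl
  L-zeroˡ w≈0 (a ∷ f) = trans
    (+-cong (trans (*-congˡ (w≈0 0)) (zeroʳ _)) (L-zeroˡ (w≈0 ∘ suc) f))
    (+-identityˡ 0#)

  L-zeroʳ : ∀ w f → (∀ i → φ (coeff f i) ≈ 0#) → L w f ≈ 0#
  L-zeroʳ w []      f≈0 = refl
  L-zeroʳ w (a ∷ f) f≈0 = trans
    (+-cong (trans (*-congʳ (f≈0 0)) (zeroˡ _)) (L-zeroʳ (w ∘ suc) f (f≈0 ∘ suc)))
    (+-identityˡ 0#)

  -- Trailing zeros allow equal polynomials to be lists of different lengths, so the surplus entries
  -- must be compared with zero. The hypothesis is taken after applying `φ` because symmetry and
  -- transitivity are available in `S`, whereas `R` is only a raw ring.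
  L-congʳ′ : ∀ w f g → (∀ i → φ (coeff f i) ≈ φ (coeff g i)) → L w f ≈ L w g
  L-congʳ′ w []      g       f≈g =
    sym (L-zeroʳ w g λ i → trans (sym (f≈g i)) 0#-homo)
  L-congʳ′ w (a ∷ f) []      f≈g =
    L-zeroʳ w (a ∷ f) λ i → trans (f≈g i) 0#-homo
  L-congʳ′ w (a ∷ f) (b ∷ g) f≈g =
    +-cong (*-congʳ (f≈g 0)) (L-congʳ′ (w ∘ suc) f g (f≈g ∘ suc))

  L-congʳ : ∀ w {f g} → f ≈ₚ g → L w f ≈ L w g
  L-congʳ w {f} {g} f≈g = L-congʳ′ w f g (⟦⟧-cong ∘ f≈g)

  L-+ₚ : ∀ w f g → L w (f +ₚ g) ≈ L w f + L w g
  L-+ₚ w []      g       = sym (+-identityˡ _)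
  L-+ₚ w (a ∷ f) []      = sym (+-identityʳ _)
  L-+ₚ w (a ∷ f) (b ∷ g) = trans
    (+-cong (trans (*-congʳ (+-homo a b)) (distribʳ _ _ _)) (L-+ₚ (w ∘ suc) f g))
    (interchange _ _ _ _)

  L-map-* : ∀ w a f → L w (map (a R.*_) f) ≈ φ a * L w f
  L-map-* w a []      = sym (zeroʳ _)
  L-map-* w a (b ∷ f) = trans
    (+-cong (trans (*-congʳ (*-homo a b)) (*-assoc _ _ _)) (L-map-* (w ∘ suc) a f))
    (sym (distribˡ _ _ _))

  L-map-neg : ∀ w f → L w (map R.-_ f) ≈ - L w f
  L-map-neg w []      = sym -0#≈0#
  L-map-neg w (a ∷ f) = trans
    (+-cong (trans (*-congʳ (-‿homo a)) (sym (-‿distribˡ-* _ _))) (L-map-neg (w ∘ suc) f))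
    (-‿+-comm _ _)

  L-shift : ∀ w f → L w (R.0# ∷ f) ≈ L (w ∘ suc) f
  L-shift w f = trans (+-congʳ (trans (*-congʳ 0#-homo) (zeroˡ _))) (+-identityˡ _)

  L-const : ∀ w a → L w (const a) ≈ φ a * w 0
  L-const w a = +-identityʳ _

  L-1 : ∀ w → L w (const R.1#) ≈ w 0
  L-1 w = trans (L-const w R.1#) (trans (*-congʳ 1#-homo) (*-identityˡ _))

  L-var : ∀ w → L w var ≈ w 1
  L-var w = trans (L-shift w (const R.1#)) (L-1 (w ∘ suc))

  -- Degrees add under multiplication: the moments seen by `g` are shifted by the degree `i` of each
  -- monomial of `f`, and the resulting values serve as moments for `f`.
  L-*ₚ : ∀ w f g → L w (f *ₚ g) ≈ L (λ i → L (λ j → w (i ℕ.+ j)) g) f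
  L-*ₚ w []      g = refl
  L-*ₚ w (a ∷ f) g = trans (L-+ₚ w (map (a R.*_) g) _)
    (+-cong (L-map-* w a g) (trans (L-shift w (f *ₚ g)) (L-*ₚ (w ∘ suc) f g)))

  L-const-*ₚ : ∀ w a f → L w (const a *ₚ f) ≈ φ a * L w f
  L-const-*ₚ w a f = trans (L-*ₚ w (const a) f) (L-const (λ i → L (λ j → w (i ℕ.+ j)) f) a)

  L-var-*ₚ : ∀ w f → L w (var *ₚ f) ≈ L (w ∘ suc) f
  L-var-*ₚ w f = trans (L-*ₚ w var f) (L-var (λ i → L (λ j → w (i ℕ.+ j)) f))

  -- This turns multiplication by a linear factor into an operation on moments, ready for the
  -- recursive step of `fallF`. By `L-*ₚ` it is enough to evaluate the inner functional on the
  -- linear factor and then use linearity in `w`.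
  L-*ₚ-linear : ∀ w f a →
    L w (f *ₚ (var +ₚ map R.-_ (const a))) ≈ L (w ∘ suc) f - φ a * L w f
  L-*ₚ-linear w f a = begin
    L w (f *ₚ (var +ₚ map R.-_ (const a)))                  ≈⟨ L-*ₚ w f _ ⟩
    L (λ i → L (λ j → w (i ℕ.+ j)) (var +ₚ map R.-_ (const a))) f
      ≈⟨ L-congˡ linear f ⟩
    L (λ i → w (suc i) + - φ a * w i) f                     ≈⟨ L-+ˡ _ _ f ⟩
    L (w ∘ suc) f + L (λ i → - φ a * w i) f                 ≈⟨ +-congˡ (L-*ˡ _ w f) ⟩
    L (w ∘ suc) f + - φ a * L w f                           ≈⟨ +-congˡ (-‿distribˡ-* _ _) ⟨
    L (w ∘ suc) f - φ a * L w f                             ∎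
    where
    linear : ∀ i → L (λ j → w (i ℕ.+ j)) (var +ₚ map R.-_ (const a))
                 ≈ w (suc i) + - φ a * w i
    linear i = begin
      L u (var +ₚ map R.-_ (const a))         ≈⟨ L-+ₚ u var (map R.-_ (const a)) ⟩
      L u var + L u (map R.-_ (const a))      ≈⟨ +-cong (L-var u) (L-const u _) ⟩
      u 1 + φ (R.- a) * u 0                   ≈⟨ +-congˡ (*-congʳ (-‿homo a)) ⟩
      u 1 + - φ a * u 0
        ≡⟨ ≡.cong₂ (λ m n → w m + - φ a * w n) (ℕ.+-comm i 1) (ℕ.+-identityʳ i) ⟩
      w (suc i) + - φ a * w i                 ∎
      where u = λ j → w (i ℕ.+ j)

  open RawSemiringDefinitions (RawRing.rawSemiring polyRawRing)
    using () renaming (_^_ to _^ₚ_; sum to sumₚ)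
  open MonoidSum +-monoid using (sum)

  L-var^ : ∀ w n → L w (var ^ₚ n) ≈ w n
  L-var^ w zero    = L-1 w
  L-var^ w (suc n) = trans (L-var-*ₚ w (var ^ₚ n)) (L-var^ (w ∘ suc) n)

  L-sum : ∀ w {n} f → L w (sumₚ {n} f) ≈ sum (L w ∘ f)
  L-sum w {zero}  f = refl
  L-sum w {suc n} f = trans
    (L-+ₚ w (f Fin.zero) (sumₚ (f ∘ Fin.suc)))
    (+-congˡ (L-sum w (f ∘ Fin.suc)))

  -- With geometric moments, `s ^ (i + j)` splits as `s ^ i * s ^ j`, so the iterated functional of
  -- `L-*ₚ` factors into a product.
  L-^-isRingHomomorphism : ∀ s →
    IsRingHomomorphism polyRawRing rawRing (L (s ^_))
  L-^-isRingHomomorphism s = record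
    { isSemiringHomomorphism = record
      { isNearSemiringHomomorphism = record
        { +-isMonoidHomomorphism = record
          { isMagmaHomomorphism = record
            { isRelHomomorphism = record { cong = λ {f} {g} → L-congʳ _ {f} {g} }
            ; homo = L-+ₚ _
            }
          ; ε-homo = refl
          }
        ; *-homo = *ₚ-homo
        }
      ; 1#-homo = L-1 (s ^_)
      }
    ; -‿homo = L-map-neg _
    }
    where
    *ₚ-homo : ∀ f g → L (s ^_) (f *ₚ g) ≈ L (s ^_) f * L (s ^_) g
    *ₚ-homo f g = begin
      L (s ^_) (f *ₚ g)                              ≈⟨ L-*ₚ _ f g ⟩
      L (λ i → L (λ j → s ^ (i ℕ.+ j)) g) f          ≈⟨ L-congˡ inner f ⟩
      L (λ i → L (s ^_) g * s ^ i) f                 ≈⟨ L-*ˡ _ _ f ⟩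
      L (s ^_) g * L (s ^_) f                        ≈⟨ *-comm _ _ ⟩
      L (s ^_) f * L (s ^_) g                        ∎
      where
      inner : ∀ i → L (λ j → s ^ (i ℕ.+ j)) g ≈ L (s ^_) g * s ^ i
      inner i = trans (L-congˡ (λ j → ^-homo-* s i j) g)
                      (trans (L-*ˡ (s ^ i) _ g) (*-comm _ _))

  -- `eval` is in Horner form; `L-*ˡ` pulls out the factor `φ t` common to all the shifted moments.
  eval≈L : ∀ t f → φ (eval t f) ≈ L (φ t ^_) f
  eval≈L t []      = 0#-homo
  eval≈L t (a ∷ f) = trans (+-homo _ _) (+-cong (sym (*-identityʳ _))
    (trans (*-homo _ _) (trans (*-congˡ (eval≈L t f)) (sym (L-*ˡ (φ t) _ f)))))

-- Generalized Stirling numbers and the Kronecker delta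

module Stirling (S : CommutativeRing c ℓ) where
  open CommutativeRing S
  open MonoidSum +-monoid using (sum; sum-cong-≋; sum-replicate-zero)
  open SetoidReasoning setoid

  -- For `k ≤ n` this is the complete homogeneous symmetric polynomial of degree n - k in `a 0`,
  -- ..., `a k`.
  stirling : (ℕ → Carrier) → ℕ → ℕ → Carrier
  stirling a zero    zero    = 1#
  stirling a zero    (suc k) = 0#
  stirling a (suc n) zero    = a 0 * stirling a n 0
  stirling a (suc n) (suc k) = stirling a n k + a (suc k) * stirling a n (suc k)

  δ : ℕ → ℕ → Carrier
  δ zero    zero    = 1#
  δ zero    (suc _) = 0#
  δ (suc _) zero    = 0#
  δ (suc m) (suc n) = δ m n

  -- Off the diagonal both sides vanish. This lets the node of the factor of `fallF` be exchanged
  -- for the node of the recursion in `L-fallF`.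
  *-δ : ∀ (a : ℕ → Carrier) m n → a m * δ m n ≈ a n * δ m n
  *-δ a zero    zero    = refl
  *-δ a zero    (suc n) = trans (zeroʳ _) (sym (zeroʳ _))
  *-δ a (suc m) zero    = trans (zeroʳ _) (sym (zeroʳ _))
  *-δ a (suc m) (suc n) = *-δ (a ∘ suc) m n

  sum-δ : ∀ (a : ℕ → Carrier) {k n} → k < n →
    sum {n} (λ i → a (toℕ i) * δ (toℕ i) k) ≈ a k
  sum-δ a {zero}  {suc n} _         = begin
    a 0 * 1# + sum {n} (λ i → a (suc (toℕ i)) * 0#)
      ≈⟨ +-cong (*-identityʳ _) (sum-cong-≋ {n} (λ i → zeroʳ _)) ⟩
    a 0 + sum {n} (λ _ → 0#)  ≈⟨ +-congˡ (sum-replicate-zero n) ⟩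
    a 0 + 0#                  ≈⟨ +-identityʳ _ ⟩
    a 0                       ∎
  sum-δ a {suc k} {suc n} (s≤s k<n) =
    trans (+-cong (zeroʳ _) (sum-δ (a ∘ suc) k<n)) (+-identityˡ _)

-- Duality between Stirling columns and falling factorials

module Duality (S : CommutativeRing c ℓ)
  {φ : RawRing.Carrier ℤ[p,q] → CommutativeRing.Carrier S}
  (φ-hom : IsRingHomomorphism ℤ[p,q] (CommutativeRing.rawRing S) φ)
  where

  open CommutativeRing S
  open IsRingHomomorphism φ-hom using (0#-homo)
  open LinearFunctional S φ-hom
  open Stirling S
  open MonoidSum +-monoid using (sum; sum-cong-≋)
  open RawSemiringDefinitions (RawRing.rawSemiring ℤ[p,q,x])
    using () renaming (_^_ to _^ₚ_; sum to sumₚ)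
  open SetoidReasoning setoid

  -- The nodes start at `F 0`, which is zero, so the leading factor `x` of `fallF` counts as
  -- `x - F 0` and no index shift is needed.
  s : ℕ → ℕ → Carrier
  s = stirling (φ ∘ F)

  column : ℕ → ℕ → Carrier
  column k n = s n k

  L-column-suc : ∀ k f →
    L (column (suc k) ∘ suc) f ≈ L (column k) f + φ (F (suc k)) * L (column (suc k)) f
  L-column-suc k f = trans (L-+ˡ _ _ f) (+-congˡ (L-*ˡ _ _ f))

  s0≈δ : ∀ k → s 0 k ≈ δ 0 k
  s0≈δ zero    = refl
  s0≈δ (suc k) = refl

  s1≈δ : ∀ k → s 1 k ≈ δ 1 k
  s1≈δ zero          = trans (*-congʳ 0#-homo) (zeroˡ _)
  s1≈δ (suc zero)    = trans (+-congˡ (zeroʳ _)) (+-identityʳ _)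
  s1≈δ (suc (suc k)) = trans (+-congˡ (zeroʳ _)) (+-identityʳ _)

  -- Induction on `n`. By the Stirling recursion, shifting column k + 1 yields column k plus
  -- `F (suc k)` times column k + 1; the factor `x - F (suc n)` subtracts `F (suc n)` times column k
  -- + 1. The two multiples of column k + 1 are supported at n = k, where their coefficients agree,
  -- so they cancel.
  L-fallF : ∀ n k → L (column k) (fallF n) ≈ δ n k
  L-fallF zero       k    = trans (L-1 (column k)) (s0≈δ k)
  L-fallF (suc zero) k    = trans (L-var (column k)) (s1≈δ k)
  L-fallF (suc (suc n)) zero = begin
    L (column 0) (fallF (suc (suc n)))
      ≈⟨ L-*ₚ-linear _ (fallF (suc n)) (F (suc n)) ⟩
    L (column 0 ∘ suc) (fallF (suc n)) - φ (F (suc n)) * L (column 0) (fallF (suc n))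
      ≈⟨ +-cong (L-*ˡ _ _ (fallF (suc n))) (-‿cong (*-congˡ (L-fallF (suc n) 0))) ⟩
    φ (F 0) * L (column 0) (fallF (suc n)) - φ (F (suc n)) * 0#
      ≈⟨ +-congʳ (*-congˡ (L-fallF (suc n) 0)) ⟩
    φ (F 0) * 0# - φ (F (suc n)) * 0#
      ≈⟨ +-cong (zeroʳ _) (-‿cong (zeroʳ _)) ⟩
    0# - 0#
      ≈⟨ -‿inverseʳ _ ⟩
    0# ∎
  L-fallF (suc (suc n)) (suc k) = begin
    L (column (suc k)) (fallF (suc (suc n)))
      ≈⟨ L-*ₚ-linear _ f (F (suc n)) ⟩
    L (column (suc k) ∘ suc) f - φ (F (suc n)) * L (column (suc k)) f
      ≈⟨ +-cong (L-column-suc k f) (-‿cong (*-congˡ (L-fallF (suc n) (suc k)))) ⟩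
    (L (column k) f + φ (F (suc k)) * L (column (suc k)) f) - φ (F (suc n)) * δ n k
      ≈⟨ +-cong (+-cong (L-fallF (suc n) k) (*-congˡ (L-fallF (suc n) (suc k))))
                (-‿cong (*-δ (φ ∘ F ∘ suc) n k)) ⟩
    (δ (suc n) k + φ (F (suc k)) * δ n k) - φ (F (suc k)) * δ n k
      ≈⟨ +-assoc _ _ _ ⟩
    δ (suc n) k + (φ (F (suc k)) * δ n k - φ (F (suc k)) * δ n k)
      ≈⟨ +-congˡ (-‿inverseʳ _) ⟩
    δ (suc n) k + 0#
      ≈⟨ +-identityʳ _ ⟩
    δ (suc n) k ∎
    where f = fallF (suc n)

  IsSf⇒stirling : ∀ Sf → IsSf Sf → ∀ {n k} → k ≤ n → φ (Sf n k) ≈ s n k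
  IsSf⇒stirling Sf isSf {n} {k} k≤n = begin
    φ (Sf n k)
      -- The bound `k ≤ n` places `k` among the `suc n` summation indices.
      ≈⟨ sum-δ (φ ∘ Sf n) (s≤s k≤n) ⟨
    sum {suc n} (λ i → φ (Sf n (toℕ i)) * δ (toℕ i) k)
      ≈⟨ sum-cong-≋ {suc n} (λ i → trans
           (L-const-*ₚ (column k) (Sf n (toℕ i)) (fallF (toℕ i)))
           (*-congˡ (L-fallF (toℕ i) k))) ⟨
    sum {suc n} (λ i → L (column k) (term i))
      ≈⟨ L-sum (column k) term ⟨
    L (column k) (sumₚ term)
      ≈⟨ L-congʳ (column k) {x ^ₚ n} {sumₚ term} (isSf n) ⟨
    L (column k) (x ^ₚ n)
      ≈⟨ L-var^ (column k) n ⟩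
    s n k ∎
    where
    term : Fin.Fin (suc n) → X.Poly
    term i = X.const (Sf n (toℕ i)) X.*ₚ fallF (toℕ i)

-- Dual numbers and the specialization homomorphism

private
  module I = Idealization ℤ.+-*-ring (TensorUnit.bimodule {R = ℤ.+-*-ring})

-- As the idealization of ℤ acting on itself: a pair `(a , b)` stands for a + b ε, and the second
-- components multiply to zero.
DualNumbers : CommutativeRing 0ℓ 0ℓ
DualNumbers = record
  { isCommutativeRing = record
    { isRing = I.isRingᴺ
    ; *-comm = λ (a , b) (a′ , b′) → ℤ.*-comm a a′ , swap a b a′ b′
    }
  }
  where
  swap : ∀ a b a′ b′ → a ℤ.* b′ ℤ.+ b ℤ.* a′ ≡ a′ ℤ.* b ℤ.+ b′ ℤ.* a
  swap = solve-∀

private module D = CommutativeRing DualNumbers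

ι-isRingHomomorphism : IsRingHomomorphism ℤ.+-*-rawRing D.rawRing I.ιᴿ
ι-isRingHomomorphism = record
  { isSemiringHomomorphism = record
    { isNearSemiringHomomorphism = record
      { +-isMonoidHomomorphism = record
        { isMagmaHomomorphism = record
          { isRelHomomorphism = record { cong = λ { ≡.refl → D.refl } }
          ; homo = λ _ _ → D.refl
          }
        ; ε-homo = D.refl
        }
      ; *-homo = λ a b → ≡.refl , zeros a b
      }
    ; 1#-homo = D.refl
    }
  ; -‿homo = λ _ → D.refl
  }
  where
  zeros : ∀ a b → + 0 ≡ a ℤ.* + 0 ℤ.+ + 0 ℤ.* b
  zeros = solve-∀

private
  module L₁ = LinearFunctional DualNumbers ι-isRingHomomorphism
  open Exp D.semiring using (_^_)

ε : D.Carrier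
ε = I.ιᴹ (+ 1)

φ₁ : P.Poly → D.Carrier
φ₁ = L₁.L (ε ^_)

φ₁-isRingHomomorphism : IsRingHomomorphism ℤ[p] D.rawRing φ₁
φ₁-isRingHomomorphism = L₁.L-^-isRingHomomorphism ε

ε^[2+n]≈0 : ∀ n → ε ^ suc (suc n) D.≈ D.0#
ε^[2+n]≈0 n = D.trans (D.sym (D.*-assoc ε ε (ε ^ n)))
  (D.trans (D.*-congʳ {ε ^ n} (I.m*m≈0 (+ 1))) (D.zeroˡ (ε ^ n)))

-- All moments from degree 2 on are multiples of ε² and vanish, so only the first two list entries
-- survive.
φ₁≈coeff : ∀ f → φ₁ f D.≈ (P.coeff f 0 , P.coeff f 1)
φ₁≈coeff []          = D.refl
φ₁≈coeff (a ∷ [])    = fst a , snd a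
  where
  fst : ∀ a → a ℤ.* + 1 ℤ.+ + 0 ≡ a
  fst = solve-∀
  snd : ∀ a → a ℤ.* + 0 ℤ.+ + 0 ℤ.* + 1 ℤ.+ + 0 ≡ + 0
  snd = solve-∀
φ₁≈coeff (a ∷ b ∷ f) = D.trans
  (D.+-congˡ {I.ιᴿ a D.* D.1#} (D.+-congˡ {I.ιᴿ b D.* (ε D.* D.1#)} (L₁.L-zeroˡ ε^[2+n]≈0 f)))
  (fst a b , snd a b)
  where
  fst : ∀ a b → a ℤ.* + 1 ℤ.+ (b ℤ.* + 0 ℤ.+ + 0) ≡ a
  fst = solve-∀
  snd : ∀ a b → (a ℤ.* + 0 ℤ.+ + 0 ℤ.* + 1)
              ℤ.+ ((b ℤ.* + 1 ℤ.+ + 0 ℤ.* + 0) ℤ.+ + 0) ≡ b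
  snd = solve-∀

private
  module L₂ = LinearFunctional DualNumbers φ₁-isRingHomomorphism

-- The value of `q` is written as the image of the unit of ℤ[p] so that `eval≈L` matches the
-- evaluation in `_⟨p,1⟩`.
φ₂ : Q.Poly → D.Carrier
φ₂ = L₂.L (φ₁ (RawRing.1# ℤ[p]) ^_)

φ₂-isRingHomomorphism : IsRingHomomorphism ℤ[p,q] D.rawRing φ₂
φ₂-isRingHomomorphism = L₂.L-^-isRingHomomorphism _

coeff-⟨p,1⟩ : ∀ f → P.coeff (f ⟨p,1⟩) 1 ≡ proj₂ (φ₂ f)
coeff-⟨p,1⟩ f = ≡.trans (≡.sym (proj₂ (φ₁≈coeff (f ⟨p,1⟩)))) (proj₂ (L₂.eval≈L _ f))

-- Truncated subtraction covers both initial values, `F 1` and `F 2`, whose ε-parts are zero. In the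
-- recursion `p` becomes ε, which sees only the constant part 1 of the earlier term, so each step
-- adds exactly one ε.
φ₂-F : ∀ m → φ₂ (F (suc m)) D.≈ (+ 1 , + (m ∸ 1))
φ₂-F 0             = D.refl
φ₂-F 1             = D.refl
φ₂-F (suc (suc m)) = begin
  φ₂ (q Q.*ₚ F₂ Q.+ₚ p Q.*ₚ F₁)
    ≈⟨ +-homo (q Q.*ₚ F₂) (p Q.*ₚ F₁) ⟩
  φ₂ (q Q.*ₚ F₂) D.+ φ₂ (p Q.*ₚ F₁)
    ≈⟨ D.+-cong (*-homo q F₂) (*-homo p F₁) ⟩
  φ₂ q D.* φ₂ F₂ D.+ φ₂ p D.* φ₂ F₁
    ≈⟨ D.+-cong (D.*-congˡ {φ₂ q} (φ₂-F (suc m))) (D.*-congˡ {φ₂ p} (φ₂-F m)) ⟩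
  (+ 1 , + 0) D.* (+ 1 , + m) D.+ (+ 0 , + 1) D.* (+ 1 , + (m ∸ 1))
    ≈⟨ ≡.refl , arith (+ m) (+ (m ∸ 1)) ⟩
  (+ 1 , + suc m) ∎
  where
  open IsRingHomomorphism φ₂-isRingHomomorphism using (+-homo; *-homo)
  open SetoidReasoning D.setoid
  F₂ = F (suc (suc m))
  F₁ = F (suc m)
  arith : ∀ a b → (+ 1 ℤ.* a ℤ.+ + 0 ℤ.* + 1) ℤ.+ (+ 0 ℤ.* b ℤ.+ + 1 ℤ.* + 1) ≡ + 1 ℤ.+ a
  arith = solve-∀

-- Closed form over the dual numbers and the coefficient formula

open import Data.Nat.Base using (_*_)
open Duality DualNumbers φ₂-isRingHomomorphism using (s; s1≈δ; IsSf⇒stirling)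

s[1+n,0]≈0 : ∀ n → s (suc n) 0 D.≈ D.0#
s[1+n,0]≈0 n = D.zeroˡ (s n 0)

-- Constant parts follow Pascal's rule. In the ε-part, the node 1 + k ε contributes an extra
-- `k * (n C suc k)`, which raises the weight `k C 2` of `n C suc k` to `suc k C 2`; Pascal's rule
-- then joins it with `n C suc (suc k)`.
s-closed : ∀ n k → s (suc n) (suc k) D.≈ (+ (n C k) , + ((k C 2) * (n C suc k)))
s-closed zero    zero    = D.refl
s-closed zero    (suc k) = D.trans (s1≈δ (suc (suc k)))
  (≡.refl , ≡.cong +_ (≡.sym (ℕ.*-zeroʳ (suc k C 2))))
s-closed (suc n) zero    = begin
  s (suc n) 0 D.+ φ₂ (F 1) D.* s (suc n) 1
    ≈⟨ D.+-cong (s[1+n,0]≈0 n) (D.*-congˡ {φ₂ (F 1)} (s-closed n 0)) ⟩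
  -- Here `φ₂ (F 1)` computes to one, and the ε-part is zero because `0 C 2` is.
  D.0# D.+ D.1# D.* (+ (n C 0) , + 0)
    ≈⟨ D.trans (D.+-identityˡ (D.1# D.* (+ (n C 0) , + 0))) (D.*-identityˡ (+ (n C 0) , + 0)) ⟩
  (+ (n C 0) , + 0) ∎
  where open SetoidReasoning D.setoid
s-closed (suc n) (suc k) = begin
  s (suc n) (suc k) D.+ φ₂ (F (suc (suc k))) D.* s (suc n) (suc (suc k))
    ≈⟨ D.+-cong (s-closed n k) (D.*-cong (φ₂-F (suc k)) (s-closed n (suc k))) ⟩
  (+ (n C k) , + ((k C 2) * (n C suc k)))
    D.+ (+ 1 , + k) D.* (+ (n C suc k) , + ((suc k C 2) * (n C suc (suc k))))
    ≈⟨ fst , snd ⟩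
  (+ (suc n C suc k) , + ((suc k C 2) * (suc n C suc (suc k)))) ∎
  where
  open SetoidReasoning D.setoid
  fst : + (n C k) ℤ.+ + 1 ℤ.* + (n C suc k) ≡ + (suc n C suc k)
  fst = ≡.trans (≡.cong (λ m → + (n C k) ℤ.+ m) (ℤ.*-identityˡ (+ (n C suc k))))
                (≡.cong +_ (nCk+nC[k+1]≡[n+1]C[k+1] n k))
  -- The ε-part is moved from ℤ to ℕ, where the binomial identities are stated.
  embed : ∀ a b c d → + a ℤ.+ (+ 1 ℤ.* + b ℤ.+ + c ℤ.* + d) ≡ + (a ℕ.+ (b ℕ.+ c * d))
  embed a b c d = ≡.cong₂ (λ u v → + a ℤ.+ (u ℤ.+ v)) (ℤ.*-identityˡ (+ b)) (≡.sym (ℤ.pos-* c d))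
  regroup : ∀ a b c d → b * c ℕ.+ ((a ℕ.+ b) * d ℕ.+ a * c) ≡ (a ℕ.+ b) * (c ℕ.+ d)
  regroup = ℕ-Solver.solve-∀
  -- Pascal's rule at 1, with `k` read as `k C 1`.
  k+kC2 : k ℕ.+ k C 2 ≡ suc k C 2
  k+kC2 = ≡.trans (≡.cong (ℕ._+ k C 2) (≡.sym (nC1≡n k))) (nCk+nC[k+1]≡[n+1]C[k+1] k 1)
  snd-ℕ : (k C 2) * (n C suc k) ℕ.+ ((suc k C 2) * (n C suc (suc k)) ℕ.+ k * (n C suc k))
        ≡ (suc k C 2) * (suc n C suc (suc k))
  snd-ℕ = ≡.subst₂
    (λ a b → (k C 2) * (n C suc k) ℕ.+ (a * (n C suc (suc k)) ℕ.+ k * (n C suc k)) ≡ a * b)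
    k+kC2 (nCk+nC[k+1]≡[n+1]C[k+1] n (suc k))
    (regroup k (k C 2) (n C suc k) (n C suc (suc k)))
  snd : + ((k C 2) * (n C suc k))
        ℤ.+ (+ 1 ℤ.* + ((suc k C 2) * (n C suc (suc k))) ℤ.+ + k ℤ.* + (n C suc k))
      ≡ + ((suc k C 2) * (suc n C suc (suc k)))
  snd = ≡.trans
    (embed ((k C 2) * (n C suc k)) ((suc k C 2) * (n C suc (suc k))) k (n C suc k))
    (≡.cong +_ snd-ℕ)

theorem12 : (Sf : ℕ → ℕ → RawRing.Carrier ℤ[p,q]) → IsSf Sf →
    ∀ n k → 3 ≤ k → k ≤ n →
    P.coeff (Sf n k ⟨p,1⟩) 1 ≡ + (((k ∸ 1) C 2) * ((n ∸ 1) C k))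
theorem12 Sf isSf (suc n) (suc k) _ k≤n =
  -- After matching on successors, the predecessors in the statement are the arguments `n` and `k`
  -- of `s-closed`.
  ≡.trans (coeff-⟨p,1⟩ (Sf (suc n) (suc k)))
    (≡.trans (proj₂ (IsSf⇒stirling Sf isSf k≤n)) (proj₂ (s-closed n k)))
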